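{- Let $k\ge 1$ and $n\ge 0$ be integers, and let $m,\ell\ge 0$ and $0\le r\le k-1$ be integers such that $m=\ell k+r$. Then: (1) the $(r+1)$-tuple of statistics $(\mathrm{pk}^*_0,\dots,\mathrm{pk}^*_r)$ on $\mathcal{P}^{k,m}_n$ is jointly equidistributed with any of its permutations; (2) the $(k-r-1)$-tuple of statistics $(\mathrm{pk}^*_{r+1},\dots,\mathrm{pk}^*_{k-1})$ on $\mathcal{P}^{k,m}_n$ is jointly equidistributed with any of its permutations.
   Context: A $(k,m)$-ballot path of down-size $n$ is a lattice path from $(0,0)$ to $((k+1)n+m,m)$ with steps $u=(1,1)$ and $d=(1,-k)$ that stays in the first quadrant (never goes below the $x$-axis). $\mathcal{P}^{k,m}_n$ is the set of all such paths. A peak is a block of two consecutive steps $ud$; its height is the second coordinate of the left endpoint of its $d$ step. For $0\le i\le k-1$, $\mathrm{pk}^*_i(P)$ is the number of all peaks of $P$ (including the rightmost peak) whose height is congruent to $i$ modulo $k$. A tuple of statistics $(s_1,\dots,s_t)$ on a finite set $S$ is jointly equidistributed with any of its permutations if for every permutation $\sigma$ of $\{1,\dots,t\}$ and all integers $v_1,\dots,v_t$, the number of $P\in S$ with $s_j(P)=v_j$ for all $j$ equals the number of $P\in S$ with $s_{\sigma(j)}(P)=v_j$ for all $j$ (vacuous if $t=0$). -}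

module Defs where

open import Data.Empty using (⊥)
open import Data.Fin using (Fin)
open import Data.Fin.Permutation using (Permutation′; _⟨$⟩ʳ_)
import Data.Fin.Properties as Fin
open import Data.Integer as ℤ using (ℤ; +_; 0ℤ; 1ℤ)
open import Data.Integer.Divisibility using (_∣_)
import Data.Integer.Properties as ℤ
open import Data.List using (List; []; _∷_; _++_; map; filter; length)
open import Data.List.Membership.Propositional using (_∈_)
open import Data.List.Membership.Propositional.Properties
  using (∈-map⁺; ∈-map⁻; ∈-++⁺ˡ; ∈-++⁺ʳ; ∈-filter⁺; ∈-filter⁻)
open import Data.List.Properties using (∷-injectiveʳ)
open import Data.List.Relation.Unary.All using (All; []; all?)
open import Data.List.Relation.Unary.Any using (here)
open import Data.List.Relation.Unary.Unique.Propositional using (Unique; []; _∷_)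
import Data.List.Relation.Unary.Unique.Propositional.Properties as Unique
open import Data.Nat as ℕ using (ℕ; zero; suc)
import Data.Nat.Divisibility as ℕ
open import Data.Product using (_×_; _,_; proj₁; proj₂)
open import Data.Product.Properties using (≡-dec)
open import Function.Bundles using (_⇔_; mk⇔)
open import Relation.Binary.PropositionalEquality
  using (_≡_; refl; sym; trans; cong; subst)
open import Relation.Nullary.Decidable using (Dec; _×-dec_)
open import Relation.Unary using (Pred; Decidable)

data Step : Set where
  u d : Step

Point : Set
Point = ℤ × ℤ

move : ℕ → Step → Point → Point
move k u (x , y) = x ℤ.+ 1ℤ , y ℤ.+ 1ℤ
move k d (x , y) = x ℤ.+ 1ℤ , y ℤ.- + k

vertices : ℕ → Point → List Step → List Point
vertices k p []      = p ∷ []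
vertices k p (s ∷ w) = p ∷ vertices k (move k s p) w

endpoint : ℕ → Point → List Step → Point
endpoint k p []      = p
endpoint k p (s ∷ w) = endpoint k (move k s p) w

origin : Point
origin = 0ℤ , 0ℤ

-- The first coordinates of the vertices are automatically nonnegative, so
-- staying in the first quadrant only constrains the second ones.
IsBallot : (k m n : ℕ) → Pred (List Step) _
IsBallot k m n w =
  endpoint k origin w ≡ (+ ((k ℕ.+ 1) ℕ.* n ℕ.+ m) , + m) ×
  All (λ p → 0ℤ ℤ.≤ proj₂ p) (vertices k origin w)

isBallot? : (k m n : ℕ) → Decidable (IsBallot k m n)
isBallot? k m n w =
  ≡-dec ℤ._≟_ ℤ._≟_ (endpoint k origin w) (+ ((k ℕ.+ 1) ℕ.* n ℕ.+ m) , + m)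
  ×-dec all? (λ p → 0ℤ ℤ.≤? proj₂ p) (vertices k origin w)

words : ℕ → List (List Step)
words zero    = [] ∷ []
words (suc N) = map (u ∷_) (words N) ++ map (d ∷_) (words N)

-- The finite set of all (k,m)-ballot paths of down-size n, as a list without
-- repetitions; see ∈-ballotPaths and ballotPaths-unique.
ballotPaths : (k m n : ℕ) → List (List Step)
ballotPaths k m n =
  filter (isBallot? k m n) (words ((k ℕ.+ 1) ℕ.* n ℕ.+ m))

∈-words : ∀ w → w ∈ words (length w)
∈-words []      = here refl
∈-words (u ∷ w) = ∈-++⁺ˡ (∈-map⁺ (u ∷_) (∈-words w))
∈-words (d ∷ w) = ∈-++⁺ʳ (map (u ∷_) (words (length w))) (∈-map⁺ (d ∷_) (∈-words w))

words-unique : ∀ N → Unique (words N)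
words-unique zero    = [] ∷ []
words-unique (suc N) =
  Unique.++⁺ (Unique.map⁺ ∷-injectiveʳ (words-unique N))
             (Unique.map⁺ ∷-injectiveʳ (words-unique N))
             disjoint
  where
  disjoint : ∀ {w} → w ∈ map (u ∷_) (words N) × w ∈ map (d ∷_) (words N) → ⊥
  disjoint (p , q) with ∈-map⁻ (u ∷_) p | ∈-map⁻ (d ∷_) q
  ... | _ , _ , refl | _ , _ , ()

endpoint-x : ∀ k p w → proj₁ (endpoint k p w) ≡ proj₁ p ℤ.+ + length w
endpoint-x k (x , y) []      = sym (ℤ.+-identityʳ x)
endpoint-x k (x , y) (u ∷ w) =
  trans (endpoint-x k _ w) (ℤ.+-assoc x 1ℤ (+ length w))
endpoint-x k (x , y) (d ∷ w) =
  trans (endpoint-x k _ w) (ℤ.+-assoc x 1ℤ (+ length w))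

∈-ballotPaths : ∀ k m n w → w ∈ ballotPaths k m n ⇔ IsBallot k m n w
∈-ballotPaths k m n w = mk⇔
  (λ w∈ → proj₂ (∈-filter⁻ (isBallot? k m n) {xs = words N} w∈))
  (λ b → ∈-filter⁺ (isBallot? k m n)
           (subst (λ L → w ∈ words L) (len b) (∈-words w)) b)
  where
  N = (k ℕ.+ 1) ℕ.* n ℕ.+ m
  len : IsBallot k m n w → length w ≡ N
  len (e , _) = ℤ.+-injective
    (trans (sym (trans (endpoint-x k origin w) (ℤ.+-identityˡ _))) (cong proj₁ e))

ballotPaths-unique : ∀ k m n → Unique (ballotPaths k m n)
ballotPaths-unique k m n =
  Unique.filter⁺ (isBallot? k m n) (words-unique ((k ℕ.+ 1) ℕ.* n ℕ.+ m))

-- The heights of the peaks of w, when w is started at height h.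
peakHeights : ℕ → ℤ → List Step → List ℤ
peakHeights k h []          = []
peakHeights k h (d ∷ w)     = peakHeights k (h ℤ.- + k) w
peakHeights k h (u ∷ [])    = []
peakHeights k h (u ∷ u ∷ w) = peakHeights k (h ℤ.+ 1ℤ) (u ∷ w)
peakHeights k h (u ∷ d ∷ w) = h ℤ.+ 1ℤ ∷ peakHeights k (h ℤ.+ 1ℤ) (d ∷ w)

_≡_mod_ : ℤ → ℤ → ℕ → Set
a ≡ b mod k = + k ∣ a ℤ.- b

_≡?_mod_ : ∀ a b k → Dec (a ≡ b mod k)
a ≡? b mod k = k ℕ.∣? ℤ.∣ a ℤ.- b ∣

pk* : (k i : ℕ) → List Step → ℕ
pk* k i w = length (filter (λ h → h ≡? + i mod k) (peakHeights k 0ℤ w))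

-- The number of x in the repetition-free list S with s j x = v j for all j.
count : ∀ {a} {A : Set a} {t} → List A → (Fin t → A → ℕ) → (Fin t → ℤ) → ℕ
count S s v = length (filter (λ x → Fin.all? (λ j → + s j x ℤ.≟ v j)) S)

JointlyEquidistributed : ∀ {a} {A : Set a} {t} → List A → (Fin t → A → ℕ) → Set
JointlyEquidistributed {t = t} S s =
  (σ : Permutation′ t) (v : Fin t → ℤ) →
  count S (λ j → s (σ ⟨$⟩ʳ j)) v ≡ count S s v

{-# OPTIONS --safe #-}
module Submission where

-- A path is determined by its gaps: writing it as
--   d^(a 0) u d^(a 1) u ... u d^(a N),  N = k n + m,
-- the number a j counts the down steps made after exactly j up steps.  The
-- vertices at that stage have heights congruent to j modulo k, because a down
-- step lowers the height by k.  Two facts follow.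
--
-- * The path stays nonnegative iff a 0 + ... + a j is at most floor (j / k) for all j.
--   This bound is constant on each block q k, ..., q k + (k - 1) and the partial
--   sums increase, so only the ends of the blocks matter: the condition is
--   that the first q + 1 blocks have total at most q, for all q
--   (isBallot⇒admissible, admissible⇒isBallot).
--
-- * A peak is a pair of an up step, the j-th one say, and a nonzero gap a j, and
--   its height is congruent to j.  As a 0 = 0, the statistic pk*_i is the number
--   of nonzero gaps at positions congruent to i modulo k (pk*-formula).
--
-- Hence permuting the gaps inside every block by one and the same permutation
-- π of the residues keeps the ballot condition and permutes the statistics
-- accordingly (rearrange-admissible, pk*-rearrange).  The only obstruction is
-- the last block, which is cut off at the last gap: since
-- N = (n + ℓ) k + r, its residues are 0, ..., r, so π has to preserve this set.
-- Both statements of the theorem follow by letting π permute one of the sets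
-- {0, ..., r} and {r + 1, ..., k - 1} and fix the other pointwise.

open import Defs
open import Data.Bool using (true; false; if_then_else_)
open import Data.Fin using (Fin; toℕ; zero; suc; _↑ˡ_; _↑ʳ_; splitAt)
import Data.Fin.Properties as Fin
open import Data.Fin.Permutation using (Permutation′; _⟨$⟩ʳ_; flip; inverseˡ)
import Data.Fin.Permutation as Perm
open import Data.Integer as ℤ using (+_; 0ℤ; 1ℤ; +≤+)
open import Data.Integer.Divisibility.Signed as Signed using (∣ᵤ⇒∣; ∣⇒∣ᵤ)
import Data.Integer.Properties as ℤ
open import Data.Integer.Tactic.RingSolver renaming (solve-∀ to ℤ-solve-∀)
open import Data.List using (List; []; _∷_; _++_; map; filter; length; replicate)
open import Data.List.Membership.Propositional using (_∈_)
open import Data.List.Membership.Propositional.Properties using (∈-map⁺; ∈-map⁻; ∈-filter⁺; ∈-filter⁻)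
open import Data.List.Membership.Propositional.Properties.WithK using (unique∧set⇒bag)
open import Data.List.Properties using (length-map; map-∘; map-id-local)
open import Data.List.Relation.Binary.BagAndSetEquality using (∼bag⇒↭)
open import Data.List.Relation.Binary.Permutation.Propositional.Properties using (↭-length)
open import Data.List.Relation.Unary.All using (All; []; _∷_; tabulate)
open import Data.List.Relation.Unary.Unique.Propositional using (Unique)
import Data.List.Relation.Unary.Unique.Propositional.Properties as Unique
open import Data.Nat using (ℕ; zero; suc; _+_; _*_; _∸_; _⊔_; _≤_; _<_; z≤n; s≤s; NonZero; >-nonZero)
open import Data.Nat.DivMod using (_/_; _%_; _divMod_; module DivMod; [m+kn]%n≡m%n; m<n⇒m%n≡m; +-distrib-/-∣ʳ; m<n⇒m/n≡0; m*n/n≡m; m/n*n≤m) renaming (_mod_ to _residue_)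
open import Data.Nat.Divisibility using (n∣m*n; ∣⇒≤)
import Data.Nat.Divisibility as ℕ
open import Data.Nat.Properties
open import Data.Nat.Tactic.RingSolver using (solve-∀)
open import Data.Product using (_×_; _,_; proj₁; proj₂)
open import Data.Sum using (inj₁; inj₂)
open import Data.Sum.Function.Propositional using (_⊎-↔_)
open import Function using (_∘_)
open import Function.Bundles using (_⇔_; mk⇔; Equivalence)
open import Function.Construct.Composition using (_⇔-∘_; _↔-∘_)
open import Function.Construct.Symmetry using (⇔-sym; ↔-sym)
open import Relation.Binary.Definitions using (tri<; tri≈; tri>)
open import Relation.Binary.PropositionalEquality
  using (_≡_; _≗_; refl; sym; trans; cong; cong₂; subst; subst₂; module ≡-Reasoning)
open import Relation.Nullary.Decidable using (does; does-⇔)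
open import Relation.Nullary.Negation using (contradiction)

open import Algebra.Properties.CommutativeMonoid.Sum +-0-commutativeMonoid
  using (sum; sum-cong-≗; sum-permute)
open import Algebra.Properties.AbelianGroup ℤ.+-0-abelianGroup using () renaming (∙-cancelʳ to ℤ-+-cancelʳ)

-- Counting through bijections

-- Equidistribution of two families of statistics from a self-map f of S that
-- turns one family into the other and has a left and right inverse g on S.
count-bijection : ∀ {a} {A : Set a} {t} {S : List A} → Unique S →
  (s s′ : Fin t → A → ℕ) (f g : A → A) →
  (∀ {x} → x ∈ S → f x ∈ S) → (∀ {x} → x ∈ S → g x ∈ S) →
  (∀ {x} → x ∈ S → g (f x) ≡ x) → (∀ {x} → x ∈ S → f (g x) ≡ x) →
  (∀ {x} → x ∈ S → ∀ j → s′ j x ≡ s j (f x)) →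
  ∀ v → count S s′ v ≡ count S s v
count-bijection {A = A} {S = S} S! s s′ f g f∈ g∈ gf fg s′≡s∘f v = begin
  length (filter P′? S)          ≡⟨ length-map f (filter P′? S) ⟨
  length (map f (filter P′? S))  ≡⟨ ↭-length (∼bag⇒↭ (unique∧set⇒bag image! (Unique.filter⁺ P? S!) (mk⇔ to from))) ⟩
  length (filter P? S)           ∎
  where
  open ≡-Reasoning
  P? = λ x → Fin.all? (λ j → + s j x ℤ.≟ v j)
  P′? = λ x → Fin.all? (λ j → + s′ j x ℤ.≟ v j)

  -- g maps the image of f back to a repetition-free list.
  image! : Unique (map f (filter P′? S))
  image! = Unique.map⁻ {f = g} (subst Unique
    (sym (trans (sym (map-∘ (filter P′? S)))
                (map-id-local (tabulate λ x∈ → gf (proj₁ (∈-filter⁻ P′? {xs = S} x∈))))))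
    (Unique.filter⁺ P′? S!))

  to : ∀ {y} → y ∈ map f (filter P′? S) → y ∈ filter P? S
  to y∈ with ∈-map⁻ f y∈
  ... | x , x∈ , refl with ∈-filter⁻ P′? {xs = S} x∈
  ... | x∈S , P′x = ∈-filter⁺ P? (f∈ x∈S)
    λ j → trans (cong +_ (sym (s′≡s∘f x∈S j))) (P′x j)

  from : ∀ {y} → y ∈ filter P? S → y ∈ map f (filter P′? S)
  from {y} y∈ with ∈-filter⁻ P? {xs = S} y∈
  ... | y∈S , Py = subst (_∈ _) (fg y∈S) (∈-map⁺ f (∈-filter⁺ P′? (g∈ y∈S) λ j →
    trans (cong +_ (trans (s′≡s∘f (g∈ y∈S) j) (cong (s j) (fg y∈S)))) (Py j)))

-- Partial sums

-- The sum f 0 + ... + f (M - 1).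
partialSum : (ℕ → ℕ) → ℕ → ℕ
partialSum f M = sum {M} (f ∘ toℕ)

partialSum-cong : ∀ {f g} → f ≗ g → ∀ M → partialSum f M ≡ partialSum g M
partialSum-cong f≗g M = sum-cong-≗ {M} (f≗g ∘ toℕ)

partialSum-zero : ∀ {f} → (∀ j → f j ≡ 0) → ∀ M → partialSum f M ≡ 0
partialSum-zero f≡0 zero    = refl
partialSum-zero f≡0 (suc M) = cong₂ _+_ (f≡0 0) (partialSum-zero (f≡0 ∘ suc) M)

partialSum-mono : ∀ f {M M′} → M ≤ M′ → partialSum f M ≤ partialSum f M′
partialSum-mono f z≤n       = z≤n
partialSum-mono f (s≤s M≤M′) = +-monoʳ-≤ (f 0) (partialSum-mono (f ∘ suc) M≤M′)

partialSum-+ : ∀ f a b → partialSum f (a + b) ≡ partialSum f a + partialSum (λ j → f (a + j)) b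
partialSum-+ f zero    b = refl
partialSum-+ f (suc a) b =
  trans (cong (_+_ (f 0)) (partialSum-+ (f ∘ suc) a b)) (sym (+-assoc (f 0) _ _))

partialSum-blocks : ∀ f k Q → partialSum f (Q * k) ≡
  sum {Q} (λ q → sum {k} (λ t → f (toℕ t + toℕ q * k)))
partialSum-blocks f k zero    = refl
partialSum-blocks f k (suc Q) = begin
  partialSum f (k + Q * k)
    ≡⟨ partialSum-+ f k (Q * k) ⟩
  partialSum f k + partialSum (λ j → f (k + j)) (Q * k)
    ≡⟨ cong₂ _+_ (sum-cong-≗ {k} λ t → cong f (sym (+-identityʳ (toℕ t))))
                 (partialSum-blocks (λ j → f (k + j)) k Q) ⟩
  sum {k} (λ t → f (toℕ t + 0)) + sum {Q} (λ q → sum {k} (λ t → f (k + (toℕ t + toℕ q * k))))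
    ≡⟨ cong (_+_ _) (sum-cong-≗ {Q} λ q → sum-cong-≗ {k} λ t →
         cong f (shift k (toℕ t) (toℕ q * k))) ⟩
  sum {k} (λ t → f (toℕ t + 0)) + sum {Q} (λ q → sum {k} (λ t → f (toℕ t + (k + toℕ q * k)))) ∎
  where
  open ≡-Reasoning
  shift : ∀ x y z → x + (y + z) ≡ y + (x + z)
  shift = solve-∀

-- Permuting positions inside blocks of length k

module _ {k : ℕ} .{{_ : NonZero k}} where

  block-decomposition : ∀ j → j ≡ toℕ (j residue k) + j / k * k
  block-decomposition j = DivMod.property (j divMod k)

  -- The map applying π to the residue modulo k, with the quotient unchanged.
  blockwise : Permutation′ k → ℕ → ℕ
  blockwise π j = toℕ (π ⟨$⟩ʳ (j residue k)) + j / k * k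

  residue-block : ∀ (t : Fin k) q → (toℕ t + q * k) residue k ≡ t
  residue-block t q = Fin.toℕ-injective (begin
    toℕ ((toℕ t + q * k) residue k) ≡⟨ Fin.toℕ-fromℕ< _ ⟩
    (toℕ t + q * k) % k ≡⟨ [m+kn]%n≡m%n (toℕ t) q k ⟩
    toℕ t % k   ≡⟨ m<n⇒m%n≡m (Fin.toℕ<n t) ⟩
    toℕ t                       ∎)
    where open ≡-Reasoning

  div-block : ∀ (t : Fin k) q → (toℕ t + q * k) / k ≡ q
  div-block t q = begin
    (toℕ t + q * k) / k     ≡⟨ +-distrib-/-∣ʳ (toℕ t) (n∣m*n q) ⟩
    toℕ t / k + q * k / k   ≡⟨ cong₂ _+_ (m<n⇒m/n≡0 (Fin.toℕ<n t)) (m*n/n≡m q k) ⟩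
    q                       ∎
    where open ≡-Reasoning

  blockwise-block : ∀ π (t : Fin k) q → blockwise π (toℕ t + q * k) ≡ toℕ (π ⟨$⟩ʳ t) + q * k
  blockwise-block π t q =
    cong₂ (λ t′ q′ → toℕ (π ⟨$⟩ʳ t′) + q′ * k) (residue-block t q) (div-block t q)

  blockwise-flip : ∀ π j → blockwise (flip π) (blockwise π j) ≡ j
  blockwise-flip π j = begin
    blockwise (flip π) (blockwise π j)
      ≡⟨ blockwise-block (flip π) (π ⟨$⟩ʳ (j residue k)) (j / k) ⟩
    toℕ (flip π ⟨$⟩ʳ (π ⟨$⟩ʳ (j residue k))) + j / k * k
      ≡⟨ cong (λ t → toℕ t + j / k * k) (inverseˡ π) ⟩
    toℕ (j residue k) + j / k * k
      ≡⟨ block-decomposition j ⟨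
    j ∎
    where open ≡-Reasoning

  partialSum-blockwise : ∀ π f Q → partialSum (f ∘ blockwise π) (Q * k) ≡ partialSum f (Q * k)
  partialSum-blockwise π f Q = begin
    partialSum (f ∘ blockwise π) (Q * k)
      ≡⟨ partialSum-blocks (f ∘ blockwise π) k Q ⟩
    sum {Q} (λ q → sum {k} (λ t → f (blockwise π (toℕ t + toℕ q * k))))
      ≡⟨ sum-cong-≗ {Q} (λ q → sum-cong-≗ {k} λ t → cong f (blockwise-block π t (toℕ q))) ⟩
    sum {Q} (λ q → sum {k} (λ t → f (toℕ (π ⟨$⟩ʳ t) + toℕ q * k)))
      ≡⟨ sum-cong-≗ {Q} (λ q → sum-permute (λ t → f (toℕ t + toℕ q * k)) π) ⟨
    sum {Q} (λ q → sum {k} (λ t → f (toℕ t + toℕ q * k)))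
      ≡⟨ partialSum-blocks f k Q ⟨
    partialSum f (Q * k) ∎
    where open ≡-Reasoning

-- π maps residues larger than r to residues larger than r.
PreservesAbove : ∀ {k} → ℕ → Permutation′ k → Set
PreservesAbove r π = ∀ t → r < toℕ t → r < toℕ (π ⟨$⟩ʳ t)

blockwise-above : ∀ {k} .{{_ : NonZero k}} {r} Q (π : Permutation′ k) → r < k →
  PreservesAbove r π → ∀ {j} → r + Q * k < j → r + Q * k < blockwise π j
blockwise-above {k} {r} Q π r<k above {j} N<j with <-cmp Q (j / k)
... | tri< Q<q _ _ = begin-strict
    r + Q * k      <⟨ +-monoˡ-< (Q * k) r<k ⟩
    suc Q * k      ≤⟨ *-monoˡ-≤ k Q<q ⟩
    j / k * k      ≤⟨ m≤n+m _ _ ⟩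
    blockwise π j  ∎
  where open ≤-Reasoning
... | tri≈ _ refl _ = +-monoˡ-< (j / k * k) (above (j residue k)
    (+-cancelʳ-< (j / k * k) r _ (subst (r + j / k * k <_) (block-decomposition j) N<j)))
... | tri> _ _ q<Q = contradiction (begin-strict
    j                         ≡⟨ block-decomposition j ⟩
    toℕ (j residue k) + j / k * k <⟨ +-monoˡ-< (j / k * k) (Fin.toℕ<n (j residue k)) ⟩
    suc (j / k) * k           ≤⟨ *-monoˡ-≤ k q<Q ⟩
    Q * k                     ≤⟨ m≤n+m _ r ⟩
    r + Q * k                 <⟨ N<j ⟩
    j                         ∎) (<-irrefl refl)
  where open ≤-Reasoning

-- Paths and their gaps

ups : List Step → ℕ
ups []      = 0
ups (u ∷ w) = suc (ups w)
ups (d ∷ w) = ups w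

downs : List Step → ℕ
downs []      = 0
downs (u ∷ w) = downs w
downs (d ∷ w) = suc (downs w)

-- gap w j is the number of down steps of w that come after exactly j up
-- steps; it is 0 if w has fewer than j up steps.
gap : List Step → ℕ → ℕ
gap []      j       = 0
gap (u ∷ w) zero    = 0
gap (u ∷ w) (suc j) = gap w j
gap (d ∷ w) zero    = suc (gap w zero)
gap (d ∷ w) (suc j) = gap w (suc j)

-- The word with N up steps and gaps a 0, ..., a N.
fromGaps : (ℕ → ℕ) → ℕ → List Step
fromGaps a zero    = replicate (a 0) d
fromGaps a (suc N) = replicate (a 0) d ++ u ∷ fromGaps (a ∘ suc) N

length≡ups+downs : ∀ w → length w ≡ ups w + downs w
length≡ups+downs []      = refl
length≡ups+downs (u ∷ w) = cong suc (length≡ups+downs w)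
length≡ups+downs (d ∷ w) = trans (cong suc (length≡ups+downs w)) (sym (+-suc (ups w) (downs w)))

gap-beyond : ∀ w {j} → ups w < j → gap w j ≡ 0
gap-beyond []      _         = refl
gap-beyond (u ∷ w) (s≤s U<j) = gap-beyond w U<j
gap-beyond (d ∷ w) U<j@(s≤s _) = gap-beyond w U<j

downs≡partialSum : ∀ w {M} → ups w < M → downs w ≡ partialSum (gap w) M
downs≡partialSum []      {M} _       = sym (partialSum-zero (λ _ → refl) M)
downs≡partialSum (u ∷ w) (s≤s U<M)   = downs≡partialSum w U<M
downs≡partialSum (d ∷ w) U<M@(s≤s _) = cong suc (downs≡partialSum w U<M)

ups-replicate-d : ∀ c w → ups (replicate c d ++ w) ≡ ups w
ups-replicate-d zero    w = refl
ups-replicate-d (suc c) w = ups-replicate-d c w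

ups-fromGaps : ∀ a N → ups (fromGaps a N) ≡ N
ups-fromGaps a zero    = go (a 0)
  where
  go : ∀ c → ups (replicate c d) ≡ 0
  go zero    = refl
  go (suc c) = go c
ups-fromGaps a (suc N) =
  trans (ups-replicate-d (a 0) _) (cong suc (ups-fromGaps (a ∘ suc) N))

gap-replicate-d-zero : ∀ c w → gap (replicate c d ++ w) 0 ≡ c + gap w 0
gap-replicate-d-zero zero    w = refl
gap-replicate-d-zero (suc c) w = cong suc (gap-replicate-d-zero c w)

gap-replicate-d-suc : ∀ c w j → gap (replicate c d ++ w) (suc j) ≡ gap w (suc j)
gap-replicate-d-suc zero    w j = refl
gap-replicate-d-suc (suc c) w j = gap-replicate-d-suc c w j

gap-replicate-d : ∀ c → gap (replicate c d) 0 ≡ c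
gap-replicate-d zero    = refl
gap-replicate-d (suc c) = cong suc (gap-replicate-d c)

gap-fromGaps : ∀ a N → (∀ {j} → N < j → a j ≡ 0) → gap (fromGaps a N) ≗ a
gap-fromGaps a zero    a≡0 zero    = gap-replicate-d (a 0)
gap-fromGaps a zero    a≡0 (suc j) =
  trans (gap-beyond (fromGaps a zero) (subst (_< suc j) (sym (ups-fromGaps a zero)) (s≤s z≤n)))
        (sym (a≡0 (s≤s z≤n)))
gap-fromGaps a (suc N) a≡0 zero    = trans (gap-replicate-d-zero (a 0) _) (+-identityʳ (a 0))
gap-fromGaps a (suc N) a≡0 (suc j) =
  trans (gap-replicate-d-suc (a 0) _ j) (gap-fromGaps (a ∘ suc) N (a≡0 ∘ s≤s) j)

fromGaps-cong : ∀ {a b} → a ≗ b → ∀ N → fromGaps a N ≡ fromGaps b N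
fromGaps-cong a≗b zero    = cong (λ c → replicate c d) (a≗b 0)
fromGaps-cong a≗b (suc N) =
  cong₂ (λ c w → replicate c d ++ u ∷ w) (a≗b 0) (fromGaps-cong (a≗b ∘ suc) N)

fromGaps-gap : ∀ w → fromGaps (gap w) (ups w) ≡ w
fromGaps-gap []      = refl
fromGaps-gap (u ∷ w) = cong (u ∷_) (fromGaps-gap w)
fromGaps-gap (d ∷ w) = trans (step (ups w)) (cong (d ∷_) (fromGaps-gap w))
  where
  step : ∀ N → fromGaps (gap (d ∷ w)) N ≡ d ∷ fromGaps (gap w) N
  step zero    = refl
  step (suc N) = refl

-- Ballot paths in terms of gaps

-- The height of the endpoint, with the descent moved to the other side.
endpoint-y : ∀ k p w → proj₂ (endpoint k p w) ℤ.+ + (k * downs w) ≡ proj₂ p ℤ.+ + ups w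
endpoint-y k (x , y) []      = cong (λ c → y ℤ.+ + c) (*-zeroʳ k)
endpoint-y k (x , y) (u ∷ w) = trans (endpoint-y k _ w) (ℤ.+-assoc y 1ℤ (+ ups w))
endpoint-y k (x , y) (d ∷ w) = begin
  e ℤ.+ + (k * suc (downs w))        ≡⟨ cong (λ c → e ℤ.+ + c) (*-suc k (downs w)) ⟩
  e ℤ.+ (+ k ℤ.+ + (k * downs w))    ≡⟨ shuffle e (+ k) (+ (k * downs w)) ⟩
  (e ℤ.+ + (k * downs w)) ℤ.+ + k    ≡⟨ cong (ℤ._+ + k) (endpoint-y k _ w) ⟩
  (y ℤ.- + k ℤ.+ + ups w) ℤ.+ + k    ≡⟨ cancel y (+ k) (+ ups w) ⟩
  y ℤ.+ + ups w                      ∎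
  where
  open ≡-Reasoning
  e = proj₂ (endpoint k (move k d (x , y)) w)
  shuffle : ∀ a b c → a ℤ.+ (b ℤ.+ c) ≡ (a ℤ.+ c) ℤ.+ b
  shuffle = ℤ-solve-∀
  cancel : ∀ a b c → (a ℤ.- b ℤ.+ c) ℤ.+ b ≡ a ℤ.+ c
  cancel = ℤ-solve-∀

All-vertices-head : ∀ {P : Point → Set} k p w → All P (vertices k p w) → P p
All-vertices-head k p []      (px ∷ _) = px
All-vertices-head k p (s ∷ w) (px ∷ _) = px

NonNegative : Point → Set
NonNegative p = 0ℤ ℤ.≤ proj₂ p

-- The lowest vertex reached after exactly j up steps, from starting height h,
-- has height h + j - k (a 0 + ... + a j).
nonNegative⇒bounded : ∀ k x h w → All NonNegative (vertices k (x , + h) w) →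
  ∀ j → k * partialSum (gap w) (suc j) ≤ h + j
nonNegative⇒bounded k x h [] _ j =
  ≤-trans (≤-reflexive (trans (cong (k *_) (partialSum-zero {gap []} (λ _ → refl) (suc j))) (*-zeroʳ k))) z≤n
nonNegative⇒bounded k x h (u ∷ w) (_ ∷ ps) zero = subst (_≤ h + 0) (sym (*-zeroʳ k)) z≤n
nonNegative⇒bounded k x h (u ∷ w) (_ ∷ ps) (suc j) =
  subst (k * partialSum (gap w) (suc j) ≤_) (+-assoc h 1 j)
        (nonNegative⇒bounded k _ (h + 1) w ps j)
nonNegative⇒bounded k x h (d ∷ w) (_ ∷ ps) j = begin
  k * suc S          ≡⟨ *-suc k S ⟩
  k + k * S          ≤⟨ +-monoʳ-≤ k (nonNegative⇒bounded k _ (h ∸ k) w ps′ j) ⟩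
  k + (h ∸ k + j)    ≡⟨ +-assoc k (h ∸ k) j ⟨
  k + (h ∸ k) + j    ≡⟨ cong (_+ j) (m+[n∸m]≡n k≤h) ⟩
  h + j              ∎
  where
  open ≤-Reasoning
  S = partialSum (gap w) (suc j)
  k≤h : k ≤ h
  k≤h = ℤ.drop‿+≤+ (ℤ.0≤i-j⇒j≤i (All-vertices-head k _ w ps))
  ps′ = subst (λ y → All NonNegative (vertices k (_ , y) w))
              (trans (ℤ.m-n≡m⊖n h k) (ℤ.⊖-≥ k≤h)) ps

bounded⇒nonNegative : ∀ k x h w → (∀ j → k * partialSum (gap w) (suc j) ≤ h + j) →
  All NonNegative (vertices k (x , + h) w)
bounded⇒nonNegative k x h [] _ = +≤+ z≤n ∷ []
bounded⇒nonNegative k x h (u ∷ w) bound = +≤+ z≤n ∷ bounded⇒nonNegative k _ (h + 1) w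
  λ j → subst (k * partialSum (gap w) (suc j) ≤_) (sym (+-assoc h 1 j)) (bound (suc j))
bounded⇒nonNegative k x h (d ∷ w) bound = +≤+ z≤n ∷
  subst (λ y → All NonNegative (vertices k (_ , y) w))
        (sym (trans (ℤ.m-n≡m⊖n h k) (ℤ.⊖-≥ k≤h)))
        (bounded⇒nonNegative k _ (h ∸ k) w λ j → +-cancelˡ-≤ k _ _ (begin
          k + k * S j        ≡⟨ *-suc k (S j) ⟨
          k * suc (S j)      ≤⟨ bound j ⟩
          h + j              ≡⟨ cong (_+ j) (m+[n∸m]≡n k≤h) ⟨
          k + (h ∸ k) + j    ≡⟨ +-assoc k (h ∸ k) j ⟩
          k + (h ∸ k + j)    ∎))
  where
  open ≤-Reasoning
  S : ℕ → ℕ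
  S j = partialSum (gap w) (suc j)
  k≤h : k ≤ h
  k≤h = begin
    k              ≤⟨ m≤m+n k (k * S 0) ⟩
    k + k * S 0    ≡⟨ *-suc k (S 0) ⟨
    k * suc (S 0)  ≤⟨ bound 0 ⟩
    h + 0          ≡⟨ +-identityʳ h ⟩
    h              ∎

-- Ballot paths by their gaps: the right numbers of steps, and at most q down
-- steps in the first q + 1 blocks of k gaps.
record Admissible (k m n : ℕ) (w : List Step) : Set where
  constructor admissible
  field
    ups≡         : ups w ≡ k * n + m
    downs≡       : downs w ≡ n
    blockBounded : ∀ q → partialSum (gap w) (suc q * k) ≤ q

module _ {k : ℕ} .{{_ : NonZero k}} where

  bounded⇒blockBounded : ∀ a → (∀ j → k * partialSum a (suc j) ≤ j) →
    ∀ q → partialSum a (suc q * k) ≤ q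
  bounded⇒blockBounded a bound q with suc q * k in eq
  ... | zero  = z≤n
  ... | suc j = m<1+n⇒m≤n (*-cancelˡ-< k _ _ (begin-strict
      k * partialSum a (suc j)  ≤⟨ bound j ⟩
      j                         <⟨ n<1+n j ⟩
      suc j                     ≡⟨ eq ⟨
      suc q * k                 ≡⟨ *-comm (suc q) k ⟩
      k * suc q                 ∎))
    where open ≤-Reasoning

  -- Inside a block j / k is constant, while the partial sums of a are largest
  -- at its end.
  blockBounded⇒bounded : ∀ a → (∀ q → partialSum a (suc q * k) ≤ q) →
    ∀ j → k * partialSum a (suc j) ≤ j
  blockBounded⇒bounded a bound j = begin
    k * partialSum a (suc j)            ≤⟨ *-monoʳ-≤ k (partialSum-mono a j<) ⟩
    k * partialSum a (suc (j / k) * k)  ≤⟨ *-monoʳ-≤ k (bound (j / k)) ⟩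
    k * (j / k)                         ≡⟨ *-comm k (j / k) ⟩
    j / k * k                           ≤⟨ m/n*n≤m j k ⟩
    j                                   ∎
    where
    open ≤-Reasoning
    j< : j < suc (j / k) * k
    j< = begin-strict
      j                          ≡⟨ block-decomposition j ⟩
      toℕ (j residue k) + j / k * k  <⟨ +-monoˡ-< (j / k * k) (Fin.toℕ<n (j residue k)) ⟩
      suc (j / k) * k            ∎

  isBallot⇒admissible : ∀ {m n w} → IsBallot k m n w → Admissible k m n w
  isBallot⇒admissible {m} {n} {w} (end , ps) =
    admissible ups≡ downs≡ (bounded⇒blockBounded (gap w) (nonNegative⇒bounded k 0ℤ 0 w ps))
    where
    height : m + k * downs w ≡ ups w
    height = ℤ.+-injective (begin
      + m ℤ.+ + (k * downs w)                              ≡⟨ cong (λ p → proj₂ p ℤ.+ + (k * downs w)) end ⟨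
      proj₂ (endpoint k origin w) ℤ.+ + (k * downs w)      ≡⟨ endpoint-y k origin w ⟩
      + ups w                                              ∎)
      where open ≡-Reasoning
    len : ups w + downs w ≡ (k + 1) * n + m
    len = ℤ.+-injective (begin
      + (ups w + downs w)             ≡⟨ cong +_ (length≡ups+downs w) ⟨
      + length w                      ≡⟨ endpoint-x k origin w ⟨
      proj₁ (endpoint k origin w)     ≡⟨ cong proj₁ end ⟩
      + ((k + 1) * n + m)             ∎)
      where open ≡-Reasoning
    downs≡ : downs w ≡ n
    downs≡ = *-cancelˡ-≡ (downs w) n (suc k) (+-cancelʳ-≡ m _ _ (begin
      suc k * downs w + m          ≡⟨ regroup k (downs w) m ⟩
      m + k * downs w + downs w    ≡⟨ cong (_+ downs w) height ⟩
      ups w + downs w              ≡⟨ len ⟩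
      (k + 1) * n + m              ≡⟨ cong (λ c → c * n + m) (+-comm k 1) ⟩
      suc k * n + m                ∎))
      where
      open ≡-Reasoning
      regroup : ∀ k x m → suc k * x + m ≡ m + k * x + x
      regroup = solve-∀
    ups≡ : ups w ≡ k * n + m
    ups≡ = trans (sym height) (trans (+-comm m _) (cong (λ x → k * x + m) downs≡))

  admissible⇒isBallot : ∀ {m n w} → Admissible k m n w → IsBallot k m n w
  admissible⇒isBallot {m} {n} {w} (admissible ups≡ downs≡ bound) =
    cong₂ _,_ end-x end-y ,
    bounded⇒nonNegative k 0ℤ 0 w (blockBounded⇒bounded (gap w) bound)
    where
    open ≡-Reasoning
    regroup : ∀ k n m → k * n + m + n ≡ (k + 1) * n + m
    regroup = solve-∀
    end-x : proj₁ (endpoint k origin w) ≡ + ((k + 1) * n + m)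
    end-x = begin
      proj₁ (endpoint k origin w)  ≡⟨ endpoint-x k origin w ⟩
      + length w                   ≡⟨ cong +_ (length≡ups+downs w) ⟩
      + (ups w + downs w)          ≡⟨ cong +_ (cong₂ _+_ ups≡ downs≡) ⟩
      + (k * n + m + n)            ≡⟨ cong +_ (regroup k n m) ⟩
      + ((k + 1) * n + m)          ∎
    end-y : proj₂ (endpoint k origin w) ≡ + m
    end-y = ℤ-+-cancelʳ (+ (k * n)) _ _ (begin
      proj₂ (endpoint k origin w) ℤ.+ + (k * n)        ≡⟨ cong (λ x → proj₂ (endpoint k origin w) ℤ.+ + (k * x)) downs≡ ⟨
      proj₂ (endpoint k origin w) ℤ.+ + (k * downs w)  ≡⟨ endpoint-y k origin w ⟩
      + ups w                                          ≡⟨ cong +_ (trans ups≡ (+-comm (k * n) m)) ⟩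
      + m ℤ.+ + (k * n)                                ∎)

-- Peaks in terms of gaps

shift-mod : ∀ {k z} → + k Signed.∣ z → ∀ x b → (x ℤ.+ z) ≡ b mod k ⇔ x ≡ b mod k
shift-mod {k} {z} k∣z x b = mk⇔
  (λ p → ∣⇒∣ᵤ (Signed.∣m+n∣n⇒∣m {m = x ℤ.- b} {n = z} (subst (+ k Signed.∣_) (move-right x z b) (∣ᵤ⇒∣ p)) k∣z))
  (λ p → ∣⇒∣ᵤ (subst (+ k Signed.∣_) (sym (move-right x z b)) (Signed.∣m∣n⇒∣m+n {m = x ℤ.- b} (∣ᵤ⇒∣ p) k∣z)))
  where
  move-right : ∀ x z b → x ℤ.+ z ℤ.- b ≡ x ℤ.- b ℤ.+ z
  move-right = ℤ-solve-∀

-- The indicator of h ≡ i modulo k.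
indicator : (k i : ℕ) → ℤ.ℤ → ℕ
indicator k i h = if does (h ≡? + i mod k) then 1 else 0

indicator-cong : ∀ {k} i i′ h h′ → h ≡ + i mod k ⇔ h′ ≡ + i′ mod k →
  indicator k i h ≡ indicator k i′ h′
indicator-cong {k} i i′ h h′ h⇔h′ =
  cong (if_then 1 else 0) (does-⇔ h⇔h′ (h ≡? + i mod k) (h′ ≡? + i′ mod k))

-- The indicator of a nonzero number.
isPositive : ℕ → ℕ
isPositive zero    = 0
isPositive (suc _) = 1

-- The statistic pk* for words started at height h.
peakCount : (k i : ℕ) → ℤ.ℤ → List Step → ℕ
peakCount k i h w = length (filter (λ h → h ≡? + i mod k) (peakHeights k h w))

peakCount-u : ∀ k i h w → peakCount k i h (u ∷ w) ≡
  indicator k i (h ℤ.+ 1ℤ) * isPositive (gap w 0) + peakCount k i (h ℤ.+ 1ℤ) w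
peakCount-u k i h []      = cong (_+ 0) (sym (*-zeroʳ (indicator k i (h ℤ.+ 1ℤ))))
peakCount-u k i h (u ∷ w) =
  cong (_+ peakCount k i (h ℤ.+ 1ℤ) (u ∷ w)) (sym (*-zeroʳ (indicator k i (h ℤ.+ 1ℤ))))
peakCount-u k i h (d ∷ w) with does ((h ℤ.+ 1ℤ) ≡? + i mod k)
... | true  = refl
... | false = refl

-- The peaks are the nonzero gaps at positions j + 1. The down steps made before
-- such a peak change its height by a multiple of k, so they are ignored.
peakCount-formula : ∀ k i h w {M} → ups w ≤ M → peakCount k i h w ≡
  partialSum (λ j → indicator k i (h ℤ.+ + suc j) * isPositive (gap w (suc j))) M
peakCount-formula k i h [] {M} _ =
  sym (partialSum-zero (λ j → *-zeroʳ (indicator k i (h ℤ.+ + suc j))) M)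
peakCount-formula k i h (u ∷ w) {suc M} (s≤s U≤M) = begin
  peakCount k i h (u ∷ w)
    ≡⟨ peakCount-u k i h w ⟩
  first + peakCount k i (h ℤ.+ 1ℤ) w
    ≡⟨ cong (_+_ first) (peakCount-formula k i (h ℤ.+ 1ℤ) w U≤M) ⟩
  first + partialSum (λ j → indicator k i (h ℤ.+ 1ℤ ℤ.+ + suc j) * isPositive (gap w (suc j))) M
    ≡⟨ cong (_+_ first) (partialSum-cong (λ j →
         cong (λ h′ → indicator k i h′ * isPositive (gap w (suc j))) (ℤ.+-assoc h 1ℤ (+ suc j))) M) ⟩
  first + partialSum (λ j → indicator k i (h ℤ.+ + suc (suc j)) * isPositive (gap w (suc j))) M ∎
  where
  open ≡-Reasoning
  first = indicator k i (h ℤ.+ 1ℤ) * isPositive (gap w 0)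
peakCount-formula k i h (d ∷ w) {M} U≤M =
  trans (peakCount-formula k i (h ℤ.- + k) w U≤M) (partialSum-cong (λ j →
    cong (_* isPositive (gap w (suc j))) (trans
      (cong (indicator k i) (swap h (ℤ.- + k) (+ suc j)))
      (indicator-cong i i (h ℤ.+ + suc j ℤ.- + k) (h ℤ.+ + suc j) (shift-mod (Signed.∣m⇒∣-m Signed.∣-refl) (h ℤ.+ + suc j) (+ i))))) M)
  where
  swap : ∀ a b c → a ℤ.+ b ℤ.+ c ≡ a ℤ.+ c ℤ.+ b
  swap = ℤ-solve-∀

-- A gap at position 0 would not be a peak, but it is empty, so the sum may
-- start at position 0.
pk*-formula : ∀ k i w {M} → gap w 0 ≡ 0 → ups w < M → pk* k i w ≡
  partialSum (λ j → indicator k i (+ j) * isPositive (gap w j)) M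
pk*-formula k i w {suc M} gap₀ (s≤s U≤M) = trans (peakCount-formula k i 0ℤ w U≤M)
  (cong (_+ partialSum (λ j → indicator k i (+ suc j) * isPositive (gap w (suc j))) M) (sym (trans (cong (λ a → indicator k i (+ 0) * isPositive a) gap₀)
                           (*-zeroʳ (indicator k i (+ 0))))))

-- Rearranging the gaps of a path

-- The word whose gap at position j is the gap of w at position blockwise π j.
rearrange : ∀ {k} .{{_ : NonZero k}} → Permutation′ k → List Step → List Step
rearrange π w = fromGaps (gap w ∘ blockwise π) (ups w)

module _ {k : ℕ} .{{_ : NonZero k}} where

  mod-residue : ∀ (t i : Fin k) q → (+ (toℕ t + q * k)) ≡ + toℕ i mod k ⇔ t ≡ i
  mod-residue t i q = mk⇔ (λ p → unique (Equivalence.to shift p)) (λ where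
    refl → Equivalence.from shift (subst (λ z → k ℕ.∣ ℤ.∣ z ∣) (sym (ℤ.+-inverseʳ (+ toℕ t))) (k ℕ.∣0)))
    where
    shift : (+ (toℕ t + q * k)) ≡ + toℕ i mod k ⇔ (+ toℕ t) ≡ + toℕ i mod k
    shift = shift-mod {z = + (q * k)} (∣ᵤ⇒∣ (n∣m*n q)) (+ toℕ t) (+ toℕ i)
    unique : (+ toℕ t) ≡ + toℕ i mod k → t ≡ i
    unique p = Fin.toℕ-injective (ℤ.+-injective (ℤ.i-j≡0⇒i≡j (+ toℕ t) (+ toℕ i)
      (ℤ.∣i∣≡0⇒i≡0 (divisible⇒zero p (begin-strict
        ℤ.∣ + toℕ t ℤ.- + toℕ i ∣  ≡⟨ cong ℤ.∣_∣ (ℤ.m-n≡m⊖n (toℕ t) (toℕ i)) ⟩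
        ℤ.∣ toℕ t ℤ.⊖ toℕ i ∣      ≤⟨ ℤ.∣m⊝n∣≤m⊔n (toℕ t) (toℕ i) ⟩
        toℕ t ⊔ toℕ i              <⟨ ⊔-pres-<m (Fin.toℕ<n t) (Fin.toℕ<n i) ⟩
        k                          ∎)))))
      where
      open ≤-Reasoning
      divisible⇒zero : ∀ {x} → k ℕ.∣ x → x < k → x ≡ 0
      divisible⇒zero {zero}  _   _   = refl
      divisible⇒zero {suc x} k∣x x<k = contradiction (∣⇒≤ k∣x) (<⇒≱ x<k)

  indicator-blockwise : ∀ π (i : Fin k) j →
    indicator k (toℕ (π ⟨$⟩ʳ i)) (+ blockwise π j) ≡ indicator k (toℕ i) (+ j)
  indicator-blockwise π i j = indicator-cong (toℕ (π ⟨$⟩ʳ i)) (toℕ i) (+ blockwise π j) (+ j)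
    (⇔-sym j⇔ ⇔-∘ (mk⇔ injective (cong (π ⟨$⟩ʳ_)) ⇔-∘ mod-residue (π ⟨$⟩ʳ (j residue k)) (π ⟨$⟩ʳ i) (j / k)))
    where
    injective : π ⟨$⟩ʳ (j residue k) ≡ π ⟨$⟩ʳ i → j residue k ≡ i
    injective eq = trans (sym (inverseˡ π)) (trans (cong (flip π ⟨$⟩ʳ_) eq) (inverseˡ π))
    j⇔ : (+ j) ≡ + toℕ i mod k ⇔ j residue k ≡ i
    j⇔ = subst (λ j′ → (+ j′) ≡ + toℕ i mod k ⇔ j residue k ≡ i) (sym (block-decomposition j))
               (mod-residue (j residue k) i (j / k))

  ups-rearrange : ∀ (π : Permutation′ k) w → ups (rearrange π w) ≡ ups w
  ups-rearrange π w = ups-fromGaps (gap w ∘ blockwise π) (ups w)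

  -- The hypothesis on ups w says that the last block of w consists of the
  -- residues 0, ..., r, so no gap is moved beyond the end of the word.
  module _ {r} (r<k : r < k) (Q : ℕ) (π : Permutation′ k) (above : PreservesAbove r π) where

    gap-rearrange : ∀ w → ups w ≡ r + Q * k → gap (rearrange π w) ≗ gap w ∘ blockwise π
    gap-rearrange w U≡ = gap-fromGaps (gap w ∘ blockwise π) (ups w) λ {j} U<j →
      gap-beyond w (subst (_< blockwise π j) (sym U≡)
        (blockwise-above Q π r<k above (subst (_< j) U≡ U<j)))

    rearrange-flip : ∀ w → ups w ≡ r + Q * k → rearrange (flip π) (rearrange π w) ≡ w
    rearrange-flip w U≡ = begin
      fromGaps (gap (rearrange π w) ∘ blockwise (flip π)) (ups (rearrange π w))
        ≡⟨ cong (fromGaps (gap (rearrange π w) ∘ blockwise (flip π))) (ups-rearrange π w) ⟩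
      fromGaps (gap (rearrange π w) ∘ blockwise (flip π)) (ups w)
        ≡⟨ fromGaps-cong (λ j → trans (gap-rearrange w U≡ _) (cong (gap w) (blockwise-flip (flip π) j))) (ups w) ⟩
      fromGaps (gap w) (ups w)
        ≡⟨ fromGaps-gap w ⟩
      w ∎
      where open ≡-Reasoning

    partialSum-rearrange : ∀ w → ups w ≡ r + Q * k → ∀ q →
      partialSum (gap (rearrange π w)) (q * k) ≡ partialSum (gap w) (q * k)
    partialSum-rearrange w U≡ q =
      trans (partialSum-cong (gap-rearrange w U≡) (q * k)) (partialSum-blockwise π (gap w) q)

    ups<blocks : ∀ w → ups w ≡ r + Q * k → ups w < suc Q * k
    ups<blocks w U≡ = subst (_< suc Q * k) (sym U≡) (+-monoˡ-< (Q * k) r<k)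

    rearrange-admissible : ∀ {m n} → k * n + m ≡ r + Q * k →
      ∀ {w} → Admissible k m n w → Admissible k m n (rearrange π w)
    rearrange-admissible {n = n} N≡ {w} (admissible ups≡ downs≡ bound) = admissible
      (trans (ups-rearrange π w) ups≡)
      (begin
        downs (rearrange π w)                              ≡⟨ downs≡partialSum (rearrange π w) U′< ⟩
        partialSum (gap (rearrange π w)) (suc Q * k)       ≡⟨ partialSum-rearrange w U≡ (suc Q) ⟩
        partialSum (gap w) (suc Q * k)                     ≡⟨ downs≡partialSum w (ups<blocks w U≡) ⟨
        downs w                                            ≡⟨ downs≡ ⟩
        n                                                  ∎)
      (λ q → subst (_≤ q) (sym (partialSum-rearrange w U≡ (suc q))) (bound q))
      where
      open ≡-Reasoning
      U≡ = trans ups≡ N≡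
      U′< = ups<blocks (rearrange π w) (trans (ups-rearrange π w) U≡)

    admissible-gap₀ : ∀ {m n w} → Admissible k m n w → gap w 0 ≡ 0
    admissible-gap₀ {w = w} (admissible _ _ bound) = n≤0⇒n≡0 (begin
      gap w 0                     ≡⟨ +-identityʳ (gap w 0) ⟨
      partialSum (gap w) 1        ≤⟨ partialSum-mono (gap w) (≤-trans (≤-trans (s≤s z≤n) r<k) (m≤m+n k 0)) ⟩
      partialSum (gap w) (1 * k)  ≤⟨ bound 0 ⟩
      0                           ∎)
      where open ≤-Reasoning

    pk*-rearrange : ∀ {m n} → k * n + m ≡ r + Q * k → ∀ {w} → Admissible k m n w →
      ∀ i → pk* k (toℕ (π ⟨$⟩ʳ i)) w ≡ pk* k (toℕ i) (rearrange π w)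
    pk*-rearrange N≡ {w} adm i = begin
      pk* k (toℕ (π ⟨$⟩ʳ i)) w
        ≡⟨ pk*-formula k (toℕ (π ⟨$⟩ʳ i)) w (admissible-gap₀ adm) (ups<blocks w U≡) ⟩
      partialSum (λ j → indicator k (toℕ (π ⟨$⟩ʳ i)) (+ j) * isPositive (gap w j)) (suc Q * k)
        ≡⟨ partialSum-blockwise π (λ j → indicator k (toℕ (π ⟨$⟩ʳ i)) (+ j) * isPositive (gap w j)) (suc Q) ⟨
      partialSum (λ j → indicator k (toℕ (π ⟨$⟩ʳ i)) (+ blockwise π j) * isPositive (gap w (blockwise π j))) (suc Q * k)
        ≡⟨ partialSum-cong (λ j → cong₂ _*_ (indicator-blockwise π i j)
             (cong isPositive (sym (gap-rearrange w U≡ j)))) (suc Q * k) ⟩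
      partialSum (λ j → indicator k (toℕ i) (+ j) * isPositive (gap (rearrange π w) j)) (suc Q * k)
        ≡⟨ pk*-formula k (toℕ i) (rearrange π w) (admissible-gap₀ (rearrange-admissible N≡ adm))
             (ups<blocks (rearrange π w) (trans (ups-rearrange π w) U≡)) ⟨
      pk* k (toℕ i) (rearrange π w) ∎
      where
      open ≡-Reasoning
      U≡ = trans (Admissible.ups≡ adm) N≡

-- Permuting two sets of residues separately

-- The permutation acting by σ on the first a indices and by τ on the last b.
_⊕_ : ∀ {a b} → Permutation′ a → Permutation′ b → Permutation′ (a + b)
σ ⊕ τ = ↔-sym Fin.+↔⊎ ↔-∘ ((σ ⊎-↔ τ) ↔-∘ Fin.+↔⊎)

⊕-↑ˡ : ∀ {a b} (σ : Permutation′ a) (τ : Permutation′ b) i → (σ ⊕ τ) ⟨$⟩ʳ (i ↑ˡ b) ≡ (σ ⟨$⟩ʳ i) ↑ˡ b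
⊕-↑ˡ {a} {b} σ τ i rewrite Fin.splitAt-↑ˡ a i b = refl

⊕-↑ʳ : ∀ {a b} (σ : Permutation′ a) (τ : Permutation′ b) i → (σ ⊕ τ) ⟨$⟩ʳ (a ↑ʳ i) ≡ a ↑ʳ (τ ⟨$⟩ʳ i)
⊕-↑ʳ {a} {b} σ τ i rewrite Fin.splitAt-↑ʳ a b i = refl

⊕-above : ∀ {r p} (σ : Permutation′ (r + 1)) (τ : Permutation′ p) → PreservesAbove r (σ ⊕ τ)
⊕-above {r} {p} σ τ t r<t with splitAt (r + 1) t in eq
... | inj₁ i = contradiction r<t (≤⇒≯ (m<1+n⇒m≤n (subst₂ _<_
      (trans (sym (Fin.toℕ-↑ˡ i p)) (cong toℕ (Fin.splitAt⁻¹-↑ˡ eq))) (+-comm r 1) (Fin.toℕ<n i))))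
... | inj₂ i = subst (r <_) (sym (Fin.toℕ-↑ʳ (r + 1) (τ ⟨$⟩ʳ i)))
      (≤-trans (≤-reflexive (+-comm 1 r)) (m≤m+n (r + 1) _))

-- The statistics at the residues i j and those at the residues π (i j) have
-- the same joint distribution, for π = σ ⊕ τ.
⊕-equidistributed : ∀ {k} n m ℓ r p → k ≡ r + 1 + p → m ≡ ℓ * k + r →
  (σ : Permutation′ (r + 1)) (τ : Permutation′ p) →
  ∀ {t} (i : Fin t → Fin (r + 1 + p)) {s s′ : Fin t → ℕ} →
  (∀ j → s j ≡ toℕ (i j)) → (∀ j → s′ j ≡ toℕ ((σ ⊕ τ) ⟨$⟩ʳ i j)) → ∀ v →
  count (ballotPaths k m n) (λ j → pk* k (s′ j)) v ≡ count (ballotPaths k m n) (λ j → pk* k (s j)) v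
⊕-equidistributed n m ℓ r p refl m≡ σ τ i s≡ s′≡ = count-bijection
  (ballotPaths-unique k m n) _ _ (rearrange π) (rearrange π⁻¹)
  (λ w∈ → member (rearrange-admissible r<k (n + ℓ) π above N≡ (gaps w∈)))
  (λ w∈ → member (rearrange-admissible r<k (n + ℓ) π⁻¹ above⁻¹ N≡ (gaps w∈)))
  (λ {w} w∈ → rearrange-flip r<k (n + ℓ) π above w (trans (Admissible.ups≡ (gaps w∈)) N≡))
  (λ {w} w∈ → rearrange-flip r<k (n + ℓ) π⁻¹ above⁻¹ w (trans (Admissible.ups≡ (gaps w∈)) N≡))
  (λ {w} w∈ j → trans (cong (λ c → pk* k c w) (s′≡ j)) (trans
    (pk*-rearrange r<k (n + ℓ) π above N≡ (gaps w∈) (i j))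
    (cong (λ c → pk* k c (rearrange π w)) (sym (s≡ j)))))
  where
  k = r + 1 + p
  r<k : r < k
  r<k = ≤-trans (≤-reflexive (+-comm 1 r)) (m≤m+n (r + 1) p)
  instance
    k≢0 : NonZero k
    k≢0 = >-nonZero (≤-trans (s≤s z≤n) r<k)
  π = σ ⊕ τ
  π⁻¹ = flip π
  above = ⊕-above σ τ
  above⁻¹ : PreservesAbove r π⁻¹
  above⁻¹ = ⊕-above (flip σ) (flip τ)
  N≡ : k * n + m ≡ r + (n + ℓ) * k
  N≡ = trans (cong (_+_ (k * n)) m≡) (regroup k n ℓ r)
    where
    regroup : ∀ k n ℓ r → k * n + (ℓ * k + r) ≡ r + (n + ℓ) * k
    regroup = solve-∀
  gaps : ∀ {w} → w ∈ ballotPaths k m n → Admissible k m n w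
  gaps {w} w∈ = isBallot⇒admissible (Equivalence.to (∈-ballotPaths k m n w) w∈)
  member : ∀ {w} → Admissible k m n w → w ∈ ballotPaths k m n
  member {w} adm = Equivalence.from (∈-ballotPaths k m n w) (admissible⇒isBallot adm)

theorem3p3 : (k n m ℓ r : ℕ) → 1 ≤ k → r ≤ k ∸ 1 → m ≡ ℓ * k + r →
    JointlyEquidistributed (ballotPaths k m n) (λ (j : Fin (r + 1)) → pk* k (toℕ j))
    × JointlyEquidistributed (ballotPaths k m n) (λ (j : Fin (k ∸ r ∸ 1)) → pk* k (r + 1 + toℕ j))
theorem3p3 k n m ℓ r 1≤k r≤k-1 m≡ =
  (λ σ → ⊕-equidistributed n m ℓ r p k≡ m≡ σ Perm.id (_↑ˡ p)
    (λ j → sym (Fin.toℕ-↑ˡ j p))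
    (λ j → sym (trans (cong toℕ (⊕-↑ˡ σ Perm.id j)) (Fin.toℕ-↑ˡ (σ ⟨$⟩ʳ j) p)))) ,
  (λ τ → ⊕-equidistributed n m ℓ r p k≡ m≡ Perm.id τ ((r + 1) ↑ʳ_)
    (λ j → sym (Fin.toℕ-↑ʳ (r + 1) j))
    (λ j → sym (trans (cong toℕ (⊕-↑ʳ Perm.id τ j)) (Fin.toℕ-↑ʳ (r + 1) (τ ⟨$⟩ʳ j)))))
  where
  p = k ∸ r ∸ 1
  k≡ : k ≡ r + 1 + p
  k≡ = sym (trans (cong (_+_ (r + 1)) (∸-+-assoc k r 1)) (m+[n∸m]≡n
    (≤-trans (+-monoˡ-≤ 1 r≤k-1) (≤-reflexive (m∸n+n≡m 1≤k)))))
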